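{- Let $n,k$ be integers with $1\le k\le n$, and let $S_{n+1}=K_{1,n}$ be the star graph on $n+1$ vertices. Then the $k$-token graph $F_k(S_{n+1})$ is isomorphic to the doubled Johnson graph $J(n;k-1,k)$.
   Context: All graphs are finite and simple. For a graph $G$ with $N$ vertices and $1\le k\le N$, the $k$-token graph $F_k(G)$ has as vertices the $k$-subsets of $V(G)$; two vertices $A,B$ are adjacent iff $A\bigtriangleup B=\{a,b\}$ with $a\in A$, $b\in B$ and $\{a,b\}$ an edge of $G$. The doubled Johnson graph $J(n;k-1,k)$ is the bipartite graph whose vertices are the $(k-1)$-subsets and the $k$-subsets of $[n]=\{1,\dots,n\}$, where distinct vertices $u,v$ are adjacent iff $u\subset v$ or $v\subset u$. -}

module Defs where

open import Data.Fin.Base using (Fin; zero; suc)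
open import Data.Fin.Subset
  using (Subset; inside; outside; _∈_; _∉_; _⊂_; _∪_; _─_; ⁅_⁆; ∣_∣)
open import Data.Fin.Subset.Properties using (∪-comm; x∈p∪q⁺; x∈p∪q⁻; x∈⁅x⁆)
open import Data.Nat.Base using (ℕ; suc)
open import Data.Product.Base using (Σ; ∃₂; _×_; _,_)
open import Data.Sum.Base using (_⊎_; inj₁; inj₂; swap; reduce)
open import Data.Vec.Base using (_∷_; there)
open import Function.Bundles using (_↔_; _⇔_; Inverse)
open import Relation.Binary.Core using (Rel)
open import Relation.Binary.Definitions using (Symmetric; Irreflexive)
open import Relation.Binary.PropositionalEquality
  using (_≡_; refl; sym; trans; subst)
open import Relation.Nullary.Negation.Core using (¬_)
open import Level using (0ℓ)

-- Finiteness is imposed through V: below, V is always Fin N or a type of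
-- subsets of Fin N.
record SimpleGraph (V : Set) : Set₁ where
  field
    Adj         : Rel V 0ℓ
    symmetric   : Symmetric Adj
    irreflexive : Irreflexive _≡_ Adj

open SimpleGraph public using (Adj)

record _≅_ {V W : Set} (G : SimpleGraph V) (H : SimpleGraph W) : Set where
  field
    bijection : V ↔ W

  open Inverse bijection public using (to; from)

  field
    adjacency : ∀ u v → Adj G u v ⇔ Adj H (to u) (to v)

infix 4 _≅_

infixl 6 _△_

_△_ : ∀ {n} → Subset n → Subset n → Subset n
A △ B = (A ─ B) ∪ (B ─ A)

△-comm : ∀ {n} (A B : Subset n) → A △ B ≡ B △ A
△-comm A B = ∪-comm (A ─ B) (B ─ A)

x∉p─p : ∀ {n} {x : Fin n} (p : Subset n) → x ∉ p ─ p
x∉p─p {x = zero}  (inside  ∷ p) ()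
x∉p─p {x = zero}  (outside ∷ p) ()
x∉p─p {x = suc x} (_ ∷ p) (there x∈) = x∉p─p p x∈

x∉p△p : ∀ {n} {x : Fin n} (p : Subset n) → x ∉ p △ p
x∉p△p p x∈ = x∉p─p p (reduce (x∈p∪q⁻ (p ─ p) (p ─ p) x∈))

data StarAdj {n : ℕ} : Rel (Fin (suc n)) 0ℓ where
  centre-leaf : ∀ i → StarAdj zero (suc i)
  leaf-centre : ∀ i → StarAdj (suc i) zero

-- star n is K_{1,n}, the star usually written S_{n+1}.
star : ∀ n → SimpleGraph (Fin (suc n))
star n = record
  { Adj         = StarAdj
  ; symmetric   = λ { (centre-leaf i) → leaf-centre i
                    ; (leaf-centre i) → centre-leaf i }
  ; irreflexive = λ { refl () }
  }

SubsetOfSize : ℕ → ℕ → Set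
SubsetOfSize N k = Σ (Subset N) λ A → ∣ A ∣ ≡ k

TokenAdj : ∀ {N k} → SimpleGraph (Fin N) → Rel (SubsetOfSize N k) 0ℓ
TokenAdj G (A , _) (B , _) =
  ∃₂ λ a b → a ∈ A × b ∈ B × Adj G a b × A △ B ≡ ⁅ a ⁆ ∪ ⁅ b ⁆

tokenGraph : ∀ {N} k → SimpleGraph (Fin N) → SimpleGraph (SubsetOfSize N k)
tokenGraph k G = record
  { Adj         = TokenAdj G
  ; symmetric   = λ { {A , _} {B , _} (a , b , a∈A , b∈B , ab , eq) →
      b , a , b∈B , a∈A , SimpleGraph.symmetric G ab ,
      trans (△-comm B A) (trans eq (∪-comm ⁅ a ⁆ ⁅ b ⁆)) }
  ; irreflexive = λ { {A , _} refl (a , b , _ , _ , _ , eq) →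
      x∉p△p A (subst (a ∈_) (sym eq) (x∈p∪q⁺ (inj₁ (x∈⁅x⁆ a)))) }
  }

-- The size k - 1 is expressed as suc ∣ A ∣ ≡ k to avoid truncated subtraction;
-- the two alternatives exclude each other, so each subset occurs at most once.
DoubledJohnsonVertex : ℕ → ℕ → Set
DoubledJohnsonVertex n k = Σ (Subset n) λ A → suc ∣ A ∣ ≡ k ⊎ ∣ A ∣ ≡ k

-- _⊂_ is proper inclusion, so adjacent vertices are distinct.
DoubledJohnsonAdj : ∀ {n k} → Rel (DoubledJohnsonVertex n k) 0ℓ
DoubledJohnsonAdj (A , _) (B , _) = A ⊂ B ⊎ B ⊂ A

-- J(n; k-1, k)
doubledJohnson : ∀ n k → SimpleGraph (DoubledJohnsonVertex n k)
doubledJohnson n k = record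
  { Adj         = DoubledJohnsonAdj
  ; symmetric   = swap
  ; irreflexive = λ { refl (inj₁ A⊂A) → ⊂-irrefl A⊂A
                    ; refl (inj₂ A⊂A) → ⊂-irrefl A⊂A }
  }
  where
  ⊂-irrefl : ∀ {A : Subset n} → ¬ (A ⊂ A)
  ⊂-irrefl (_ , _ , x∈A , x∉A) = x∉A x∈A

{-# OPTIONS --safe #-}

-- Record a k-subset of the star's vertices by its leaves: k - 1 of them if the
-- centre carries a token, k otherwise.  A token move goes between the centre and
-- a leaf, so it toggles the centre and adds or removes exactly one leaf.

module Submission where

open import Defs
open import Data.Nat.Base using (ℕ; suc; _≤_)
open import Data.Nat.Properties using (suc-injective; <-irrefl; <-asym; ≤-reflexive)

open import Data.Fin.Base using (zero; suc)
open import Data.Fin.Subset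
  using (Subset; inside; outside; _∈_; _⊆_; _⊂_; _∪_; ⁅_⁆; ∣_∣)
  renaming (⊥ to ∅)
open import Data.Fin.Subset.Properties
  using (drop-∷-⊆; out⊂in; s⊂s; ⊆-reflexive; p⊆q⇒∣p∣≤∣q∣; p⊂q⇒∣p∣<∣q∣; ∪-identityˡ)
open import Data.Product.Base using (∃; _×_; _,_)
open import Data.Sum.Base using (inj₁; inj₂; [_,_])
open import Data.Vec.Base using ([]; _∷_; here; there)
open import Data.Vec.Properties using (∷-injectiveʳ)
open import Function.Base using (_∘_)
open import Function.Bundles using (_⇔_; _↔_; mk⇔; mk↔ₛ′; Equivalence)
open import Relation.Binary.PropositionalEquality
  using (_≡_; refl; sym; trans; cong; subst)
open import Relation.Nullary.Negation using (¬_; contradiction)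

p△p≡∅ : ∀ {n} (p : Subset n) → p △ p ≡ ∅
p△p≡∅ []            = refl
p△p≡∅ (inside  ∷ p) = cong (outside ∷_) (p△p≡∅ p)
p△p≡∅ (outside ∷ p) = cong (outside ∷_) (p△p≡∅ p)

p△q≡∅⇒p≡q : ∀ {n} (p q : Subset n) → p △ q ≡ ∅ → p ≡ q
p△q≡∅⇒p≡q []            []            _  = refl
p△q≡∅⇒p≡q (inside  ∷ p) (inside  ∷ q) eq = cong (inside  ∷_) (p△q≡∅⇒p≡q p q (∷-injectiveʳ eq))
p△q≡∅⇒p≡q (outside ∷ p) (outside ∷ q) eq = cong (outside ∷_) (p△q≡∅⇒p≡q p q (∷-injectiveʳ eq))
p△q≡∅⇒p≡q (inside  ∷ p) (outside ∷ q) ()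
p△q≡∅⇒p≡q (outside ∷ p) (inside  ∷ q) ()

p⊆q∧∣p∣≡∣q∣⇒p≡q : ∀ {n} (p q : Subset n) → p ⊆ q → ∣ p ∣ ≡ ∣ q ∣ → p ≡ q
p⊆q∧∣p∣≡∣q∣⇒p≡q []            []            _   _  = refl
p⊆q∧∣p∣≡∣q∣⇒p≡q (inside  ∷ p) (inside  ∷ q) p⊆q eq =
  cong (inside ∷_) (p⊆q∧∣p∣≡∣q∣⇒p≡q p q (drop-∷-⊆ p⊆q) (suc-injective eq))
p⊆q∧∣p∣≡∣q∣⇒p≡q (outside ∷ p) (outside ∷ q) p⊆q eq =
  cong (outside ∷_) (p⊆q∧∣p∣≡∣q∣⇒p≡q p q (drop-∷-⊆ p⊆q) eq)
p⊆q∧∣p∣≡∣q∣⇒p≡q (inside  ∷ p) (outside ∷ q) p⊆q _  = contradiction (p⊆q here) λ ()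
-- Here `eq` makes the tail `p` one larger than the tail `q`, yet it is contained in it.
p⊆q∧∣p∣≡∣q∣⇒p≡q (outside ∷ p) (inside  ∷ q) p⊆q eq =
  contradiction (subst (_≤ ∣ q ∣) eq (p⊆q⇒∣p∣≤∣q∣ (drop-∷-⊆ p⊆q))) (<-irrefl refl)

-- Descend to the position of `x`: before it the heads agree, since `⁅ x ⁆` has `outside` there; at
-- it only `q` has the element; after it the symmetric difference is empty, so the tails coincide.
x∈q∧p△q≡⁅x⁆⇒p⊂q : ∀ {n} (p q : Subset n) {x} → x ∈ q → p △ q ≡ ⁅ x ⁆ → p ⊂ q
x∈q∧p△q≡⁅x⁆⇒p⊂q (inside  ∷ p) (inside  ∷ q) here        ()
x∈q∧p△q≡⁅x⁆⇒p⊂q (outside ∷ p) (inside  ∷ q) here        eq =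
  out⊂in (⊆-reflexive (p△q≡∅⇒p≡q p q (∷-injectiveʳ eq)))
x∈q∧p△q≡⁅x⁆⇒p⊂q (inside  ∷ p) (inside  ∷ q) (there x∈q) eq =
  s⊂s (x∈q∧p△q≡⁅x⁆⇒p⊂q p q x∈q (∷-injectiveʳ eq))
x∈q∧p△q≡⁅x⁆⇒p⊂q (outside ∷ p) (outside ∷ q) (there x∈q) eq =
  s⊂s (x∈q∧p△q≡⁅x⁆⇒p⊂q p q x∈q (∷-injectiveʳ eq))
x∈q∧p△q≡⁅x⁆⇒p⊂q (inside  ∷ p) (outside ∷ q) (there _)   ()
x∈q∧p△q≡⁅x⁆⇒p⊂q (outside ∷ p) (inside  ∷ q) (there _)   ()

-- The witness is the first position where the heads differ. The size gap is used up there, so the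
-- remaining tails are nested and of equal size, hence equal.
p⊆q∧∣q∣≡1+∣p∣⇒p△q≡⁅x⁆ : ∀ {n} (p q : Subset n) → p ⊆ q → ∣ q ∣ ≡ suc ∣ p ∣ →
                        ∃ λ x → x ∈ q × p △ q ≡ ⁅ x ⁆
p⊆q∧∣q∣≡1+∣p∣⇒p△q≡⁅x⁆ (inside  ∷ p) (inside  ∷ q) p⊆q eq
  with x , x∈q , p△q≡⁅x⁆ ← p⊆q∧∣q∣≡1+∣p∣⇒p△q≡⁅x⁆ p q (drop-∷-⊆ p⊆q) (suc-injective eq)
  = suc x , there x∈q , cong (outside ∷_) p△q≡⁅x⁆
p⊆q∧∣q∣≡1+∣p∣⇒p△q≡⁅x⁆ (outside ∷ p) (outside ∷ q) p⊆q eq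
  with x , x∈q , p△q≡⁅x⁆ ← p⊆q∧∣q∣≡1+∣p∣⇒p△q≡⁅x⁆ p q (drop-∷-⊆ p⊆q) eq
  = suc x , there x∈q , cong (outside ∷_) p△q≡⁅x⁆
p⊆q∧∣q∣≡1+∣p∣⇒p△q≡⁅x⁆ (inside  ∷ p) (outside ∷ q) p⊆q _  = contradiction (p⊆q here) λ ()
p⊆q∧∣q∣≡1+∣p∣⇒p△q≡⁅x⁆ (outside ∷ p) (inside  ∷ q) p⊆q eq
  with refl ← p⊆q∧∣p∣≡∣q∣⇒p≡q p q (drop-∷-⊆ p⊆q) (sym (suc-injective eq))
  = zero , here , cong (inside ∷_) (p△p≡∅ p)

∣p∣≡∣q∣⇒p⊄q : ∀ {n} {p q : Subset n} → ∣ p ∣ ≡ ∣ q ∣ → ¬ (p ⊂ q)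
∣p∣≡∣q∣⇒p⊄q eq p⊂q = <-irrefl eq (p⊂q⇒∣p∣<∣q∣ p⊂q)

-- Every edge of the star contains the centre `zero`, so the union of its two endpoints starts with
-- `inside`.
starAdj⇒pair≢outside∷ : ∀ {n a b} {p : Subset n} → StarAdj a b → ¬ (outside ∷ p ≡ ⁅ a ⁆ ∪ ⁅ b ⁆)
starAdj⇒pair≢outside∷ (centre-leaf _) ()
starAdj⇒pair≢outside∷ (leaf-centre _) ()

module _ {n k : ℕ} where

  -- Since `∣ inside ∷ A ∣` reduces to `suc ∣ A ∣` and `∣ outside ∷ A ∣` to `∣ A ∣`, the size proof
  -- is carried over unchanged in both directions.
  leaves : SubsetOfSize (suc n) k → DoubledJohnsonVertex n k
  leaves (inside  ∷ A , ∣A∣) = A , inj₁ ∣A∣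
  leaves (outside ∷ A , ∣A∣) = A , inj₂ ∣A∣

  restoreCentre : DoubledJohnsonVertex n k → SubsetOfSize (suc n) k
  restoreCentre (A , inj₁ ∣A∣) = inside  ∷ A , ∣A∣
  restoreCentre (A , inj₂ ∣A∣) = outside ∷ A , ∣A∣

  leaves-↔ : SubsetOfSize (suc n) k ↔ DoubledJohnsonVertex n k
  leaves-↔ = mk↔ₛ′ leaves restoreCentre
    (λ { (_ , inj₁ _) → refl ; (_ , inj₂ _) → refl })
    (λ { (inside ∷ _ , _) → refl ; (outside ∷ _ , _) → refl })

  private
    TAdj = Adj (tokenGraph {suc n} k (star n))
    JAdj = Adj (doubledJohnson n k)

  centre-move-⇔ : ∀ A B ∣A∣ ∣B∣ →
                  TAdj (inside ∷ A , ∣A∣) (outside ∷ B , ∣B∣) ⇔ JAdj (A , inj₁ ∣A∣) (B , inj₂ ∣B∣)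
  centre-move-⇔ A B ∣A∣ ∣B∣ = mk⇔ to from
    where
    ∣B∣≡1+∣A∣ : ∣ B ∣ ≡ suc ∣ A ∣
    ∣B∣≡1+∣A∣ = trans ∣B∣ (sym ∣A∣)

    to : TAdj (inside ∷ A , ∣A∣) (outside ∷ B , ∣B∣) → JAdj (A , inj₁ ∣A∣) (B , inj₂ ∣B∣)
    -- The move cannot end at the centre, which is not in `outside ∷ B`. The tail of `eq` reads
    -- `A △ B ≡ ∅ ∪ ⁅ i ⁆`.
    to (_ , _ , _ , there i∈B , centre-leaf i , eq) =
      inj₁ (x∈q∧p△q≡⁅x⁆⇒p⊂q A B i∈B (trans (∷-injectiveʳ eq) (∪-identityˡ ⁅ i ⁆)))

    from : JAdj (A , inj₁ ∣A∣) (B , inj₂ ∣B∣) → TAdj (inside ∷ A , ∣A∣) (outside ∷ B , ∣B∣)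
    from (inj₁ (A⊆B , _))
      with i , i∈B , A△B≡⁅i⁆ ← p⊆q∧∣q∣≡1+∣p∣⇒p△q≡⁅x⁆ A B A⊆B ∣B∣≡1+∣A∣
      = zero , suc i , here , there i∈B , centre-leaf i ,
        cong (inside ∷_) (trans A△B≡⁅i⁆ (sym (∪-identityˡ ⁅ i ⁆)))
    -- Excluded by size: `B` has one element more than `A`.
    from (inj₂ B⊂A) =
      contradiction (p⊂q⇒∣p∣<∣q∣ B⊂A) (<-asym (≤-reflexive (sym ∣B∣≡1+∣A∣)))

  leaves-adjacency : ∀ u v → TAdj u v ⇔ JAdj (leaves u) (leaves v)
  leaves-adjacency (inside ∷ A , ∣A∣) (outside ∷ B , ∣B∣) = centre-move-⇔ A B ∣A∣ ∣B∣
  -- A move into the centre is a move out of it reversed, so symmetry of both graphs reduces this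
  -- case to the previous one.
  leaves-adjacency u@(outside ∷ A , ∣A∣) v@(inside ∷ B , ∣B∣) = mk⇔
    (J.symmetric {leaves v} {leaves u} ∘ Equivalence.to vu ∘ T.symmetric {u} {v})
    (T.symmetric {v} {u} ∘ Equivalence.from vu ∘ J.symmetric {leaves u} {leaves v})
    where
    module T = SimpleGraph (tokenGraph {suc n} k (star n))
    module J = SimpleGraph (doubledJohnson n k)
    vu = centre-move-⇔ B A ∣B∣ ∣A∣
  -- When the two sets agree on the centre, neither side has an edge: the symmetric difference
  -- misses the centre, and leaf sets of equal size are never properly nested.
  leaves-adjacency (inside ∷ A , ∣A∣) (inside ∷ B , ∣B∣) = mk⇔
    (λ { (_ , _ , _ , _ , ab , eq) → contradiction eq (starAdj⇒pair≢outside∷ ab) })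
    [ (λ A⊂B → contradiction A⊂B (∣p∣≡∣q∣⇒p⊄q ∣A∣≡∣B∣))
    , (λ B⊂A → contradiction B⊂A (∣p∣≡∣q∣⇒p⊄q (sym ∣A∣≡∣B∣))) ]
    where ∣A∣≡∣B∣ = suc-injective (trans ∣A∣ (sym ∣B∣))
  leaves-adjacency (outside ∷ A , ∣A∣) (outside ∷ B , ∣B∣) = mk⇔
    (λ { (_ , _ , _ , _ , ab , eq) → contradiction eq (starAdj⇒pair≢outside∷ ab) })
    [ (λ A⊂B → contradiction A⊂B (∣p∣≡∣q∣⇒p⊄q ∣A∣≡∣B∣))
    , (λ B⊂A → contradiction B⊂A (∣p∣≡∣q∣⇒p⊄q (sym ∣A∣≡∣B∣))) ]
    where ∣A∣≡∣B∣ = trans ∣A∣ (sym ∣B∣)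

mainTheorem7 : (n k : ℕ) → 1 ≤ k → k ≤ n → tokenGraph k (star n) ≅ doubledJohnson n k
mainTheorem7 n k _ _ = record
  { bijection = leaves-↔
  ; adjacency = leaves-adjacency
  }
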